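{- Let $r$ be a positive integer and $d$ be a nonnegative integer such that $r\ge d$. For every integer $n\ge d$ and every positive integer $N$, we have $$\sum_{k=0}^{N-1}q^{rk}[k]^{n-d}=\frac{q^{(r-d)N}\,T_n(N)-T_n(0)}{n(n-1)\cdots(n-d+1)},$$ where $(T_k(X))_{k\ge 0}$ is the Carlitz-type $q$-polynomial sequence associated to the real sequence of general term $$b_k=(q-1)^{d-1}\,\frac{k(k-1)\cdots(k-d+1)}{[k+r-d]}\qquad(\forall k\ge 0).$$
   Context: Let $q$ be a positive real parameter, $q\neq 1$, and put $[X]:=\frac{q^X-1}{q-1}$, where $X$ is an indeterminate or a number. A $q$-polynomial is a polynomial in $q^X$ (equivalently in $[X]$) with real coefficients. The Carlitz-type $q$-polynomial sequence associated to a real sequence $(a_k)_{k\ge 0}$ is the sequence $(T_n(X))_{n\ge 0}$ defined by $$T_n(X)=(q-1)^{ -n}\sum_{k=0}^{n}(-1)^{n-k}\binom{n}{k}a_k\,q^{kX}.$$ Products $m(m-1)\cdots(m-d+1)$ are empty, hence equal to $1$, when $d=0$, and $[k]^0=1$ (also for $k=0$). The paper's convention is that $\frac{k}{[k]}=1$ for $k=0$. -}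

module Defs where

open import Level using (_⊔_) renaming (suc to lsuc)
open import Data.Nat.Base as ℕ using (ℕ; zero; suc; _∸_)
import Data.Nat.Properties as ℕₚ
open import Data.Nat.Combinatorics using (_C_)
open import Data.Integer.Base as ℤ using (ℤ; -[1+_])
open import Data.Fin.Base using (Fin; zero; suc; toℕ)
import Data.Fin.Properties as Finₚ
open import Data.Product.Base using (∃-syntax; _×_; _,_; proj₁; proj₂)
open import Data.Sum.Base using (_⊎_; inj₁; inj₂; [_,_]′)
open import Data.Empty using (⊥-elim)
open import Function.Base using (_∘_)
open import Function.Bundles using (_⇔_; Equivalence)
open import Relation.Binary.Core using (Rel)
open import Relation.Binary.Structures using (IsStrictPartialOrder)
open import Algebra.Bundles using (CommutativeRing; Semiring)
open import Algebra.Apartness.Bundles using (HeytingField)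
import Algebra.Apartness.Properties.HeytingCommutativeRing as HCRProperties
import Algebra.Properties.Ring as RingProperties
import Algebra.Definitions.RawSemiring as RawSemiringDefinitions

-- The real numbers, given by their characterisation as the Cauchy-complete
-- Archimedean ordered field.  Everything is phrased with the apartness _#_
-- so that both the classical reals (where x # y is x ≢ y) and the
-- constructive Cauchy reals are models.

record RealNumbers c ℓ₁ ℓ₂ : Set (lsuc (c ⊔ ℓ₁ ⊔ ℓ₂)) where
  field
    heytingField : HeytingField c ℓ₁ ℓ₂

  open HeytingField heytingField public hiding (zero)

  commutativeRing : CommutativeRing c ℓ₁
  commutativeRing = record { isCommutativeRing = isCommutativeRing }

  -- n ℕ× x is the n-fold sum x + ⋯ + x.
  open RawSemiringDefinitions (Semiring.rawSemiring (CommutativeRing.semiring commutativeRing)) public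
    using (_^_; sum; product) renaming (_×_ to _ℕ×_)

  infix 4 _<_
  field
    _<_                  : Rel Carrier ℓ₂
    isStrictPartialOrder : IsStrictPartialOrder _≈_ _<_
    #⇔<⊎>                : ∀ {x y} → x # y ⇔ (x < y ⊎ y < x)
    +-monoˡ-<            : ∀ {x y} z → x < y → x + z < y + z
    *-pos                : ∀ {x y} → 0# < x → 0# < y → 0# < x * y

    archimedean : ∀ x → ∃[ n ] x < n ℕ× 1#

    -- As m and n range independently, the first condition bounds |s m - s n|.
    complete : ∀ (s : ℕ → Carrier) →
      (∀ ε → 0# < ε → ∃[ M ] (∀ m n → M ℕ.≤ m → M ℕ.≤ n → s m - s n < ε)) →
      ∃[ l ] (∀ ε → 0# < ε →
        ∃[ M ] (∀ n → M ℕ.≤ n → (s n - l < ε) × (l - s n < ε)))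

module RealProperties {c ℓ₁ ℓ₂} (ℝ : RealNumbers c ℓ₁ ℓ₂) where
  open RealNumbers ℝ
  open CommutativeRing commutativeRing using (ring)
  open RingProperties ring
    using (-‿distribˡ-*; -‿distribʳ-*; -‿involutive)
  open HCRProperties (HeytingField.heytingCommutativeRing heytingField)
    using (x-0≈x; 1#0; invertibleˡ⇒#; x#0y#0→xy#0)
  private module < = IsStrictPartialOrder isStrictPartialOrder

  <⇒# : ∀ {x y} → x < y → x # y
  <⇒# = Equivalence.from #⇔<⊎> ∘ inj₁

  x<y⇒0<y-x : ∀ {x y} → x < y → 0# < y - x
  x<y⇒0<y-x {x} x<y = <.<-respˡ-≈ (-‿inverseʳ x) (+-monoˡ-< (- x) x<y)

  0<y-x⇒x<y : ∀ {x y} → 0# < y - x → x < y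
  0<y-x⇒x<y {x} {y} p = <.<-respʳ-≈ y-x+x≈y (<.<-respˡ-≈ (+-identityˡ x) (+-monoˡ-< x p))
    where
    y-x+x≈y : y - x + x ≈ y
    y-x+x≈y = trans (+-assoc y (- x) x) (trans (+-congˡ (-‿inverseˡ x)) (+-identityʳ y))

  *-monoˡ-< : ∀ {x y z} → 0# < z → x < y → z * x < z * y
  *-monoˡ-< {x} {y} {z} 0<z x<y = 0<y-x⇒x<y (<.<-respʳ-≈ eq (*-pos 0<z (x<y⇒0<y-x x<y)))
    where
    eq : z * (y - x) ≈ z * y - z * x
    eq = trans (distribˡ z y (- x)) (+-congˡ (sym (-‿distribʳ-* z x)))

  0<1 : 0# < 1#
  0<1 = [ (λ 1<0 → ⊥-elim (<.asym 1<0 (neg 1<0))) , (λ 0<1 → 0<1) ]′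
          (Equivalence.to #⇔<⊎> 1#0)
    where
    neg : 1# < 0# → 0# < 1#
    neg 1<0 = <.<-respʳ-≈ sq (*-pos 0<-1 0<-1)
      where
      0<-1 : 0# < - 1#
      0<-1 = <.<-respʳ-≈ (+-identityˡ (- 1#)) (x<y⇒0<y-x 1<0)
      sq : - 1# * - 1# ≈ 1#
      sq = trans (sym (-‿distribˡ-* 1# (- 1#)))
             (trans (-‿cong (*-identityˡ (- 1#))) (-‿involutive 1#))

  #⇒-#0 : ∀ {x y} → x # y → x - y # 0#
  #⇒-#0 {x} {y} x#y with #⇒invertible x#y
  ... | i , i*[x-y]≈1 , _ = invertibleˡ⇒# (i , trans (*-congˡ (x-0≈x (x - y))) i*[x-y]≈1)

  inv : ∀ x → x # 0# → Carrier
  inv x x#0 = proj₁ (#⇒invertible x#0)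

  *-invʳ : ∀ {x} (x#0 : x # 0#) → x * inv x x#0 ≈ 1#
  *-invʳ {x} x#0 = trans (*-congʳ (sym (x-0≈x x))) (proj₂ (proj₂ (#⇒invertible x#0)))

  inv#0 : ∀ {x} (x#0 : x # 0#) → inv x x#0 # 0#
  inv#0 {x} x#0 = invertibleˡ⇒# (x , trans (*-congˡ (x-0≈x (inv x x#0))) (*-invʳ x#0))

  infixl 7 _/_⟨_⟩
  _/_⟨_⟩ : ∀ x y → y # 0# → Carrier
  x / y ⟨ y#0 ⟩ = x * inv y y#0

  ι : ℕ → Carrier
  ι n = n ℕ× 1#

  ι<ι[1+n] : ∀ n → ι n < ι (suc n)
  ι<ι[1+n] n = <.<-respˡ-≈ (+-identityˡ (ι n)) (+-monoˡ-< (ι n) 0<1)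

  ι-mono-< : ∀ {m n} → m ℕ.< n → ι m < ι n
  ι-mono-< {m} m<n = go (ℕₚ.≤⇒≤′ m<n)
    where
    go : ∀ {n} → suc m ℕ.≤′ n → ι m < ι n
    go ℕ.≤′-refl             = ι<ι[1+n] m
    go (ℕ.≤′-step {n = n} p) = <.trans (go p) (ι<ι[1+n] n)

  -- x (x - 1) ⋯ (x - d + 1)
  falling : ℕ → ℕ → Carrier
  falling x d = product {d} (λ i → ι x - ι (toℕ i))

  product-pos : ∀ {m} (f : Fin m → Carrier) → (∀ i → 0# < f i) → 0# < product f
  product-pos {zero}  f 0<f = 0<1
  product-pos {suc m} f 0<f = *-pos (0<f zero) (product-pos (f ∘ suc) (0<f ∘ suc))

  falling#0 : ∀ {n d} → d ℕ.≤ n → falling n d # 0#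
  falling#0 {n} {d} d≤n = #-sym (<⇒# (product-pos _ λ i →
    x<y⇒0<y-x (ι-mono-< {toℕ i} (ℕₚ.<-≤-trans (Finₚ.toℕ<n i) d≤n))))

  module QCalculus (q : Carrier) (0<q : 0# < q) (q#1 : q # 1#) where

    q^[1+m]#1 : ∀ m → q ^ suc m # 1#
    q^[1+m]#1 m = [ <⇒# ∘ below m , #-sym ∘ <⇒# ∘ above m ]′ (Equivalence.to #⇔<⊎> q#1)
      where
      below : ∀ m → q < 1# → q ^ suc m < 1#
      below zero    q<1 = <.<-respˡ-≈ (sym (*-identityʳ q)) q<1
      below (suc m) q<1 =
        <.trans (<.<-respʳ-≈ (*-identityʳ q) (*-monoˡ-< 0<q (below m q<1))) q<1
      above : ∀ m → 1# < q → 1# < q ^ suc m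
      above zero    1<q = <.<-respʳ-≈ (sym (*-identityʳ q)) 1<q
      above (suc m) 1<q =
        <.trans 1<q (<.<-respˡ-≈ (*-identityʳ q) (*-monoˡ-< 0<q (above m 1<q)))

    q-1#0 : q - 1# # 0#
    q-1#0 = #⇒-#0 q#1

    [_] : ℕ → Carrier
    [ x ] = (q ^ x - 1#) / (q - 1#) ⟨ q-1#0 ⟩

    [1+m]#0 : ∀ m → [ suc m ] # 0#
    [1+m]#0 m = x#0y#0→xy#0 (#⇒-#0 (q^[1+m]#1 m)) (inv#0 q-1#0)

    [q-1]^_ : ℤ → Carrier
    [q-1]^ (ℤ.+ n)   = (q - 1#) ^ n
    [q-1]^ -[1+ n ] = inv (q - 1#) q-1#0 ^ suc n

    -- The value at X = x of the n-th Carlitz-type q-polynomial associated to a.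
    carlitz : (ℕ → Carrier) → ℕ → ℕ → Carrier
    carlitz a n x =
      [q-1]^ (ℤ.- (ℤ.+ n)) *
      sum {suc n} (λ k → (- 1#) ^ (n ∸ toℕ k) * ι (n C toℕ k) * a (toℕ k) * q ^ (toℕ k ℕ.* x))

    -- k (k - 1) ⋯ (k - d + 1) / [j], for j = k + r - d.  Since r ≥ 1, the case
    -- j = 0 only arises for k = 0 and d = r ≥ 1; there k / [k] is read as 1, which
    -- leaves (k - 1) ⋯ (k - d + 1).
    falling/[] : (k d j : ℕ) → Carrier
    falling/[] k d zero    = product {d ∸ 1} (λ i → ι k - ι (suc (toℕ i)))
    falling/[] k d (suc j) = falling k d / [ suc j ] ⟨ [1+m]#0 j ⟩

    b : (r d : ℕ) → ℕ → Carrier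
    b r d k = [q-1]^ (ℤ.+ d ℤ.- ℤ.+ 1) * falling/[] k d (k ℕ.+ (r ∸ d))

{-# OPTIONS --safe #-}

-- Put h(x) = q^((r-d)x) T_n(x).  Multiplying the k-th term of h by q^(k+r-d)
-- turns h(x) into h(x+1), and the factor q^(k+r-d) - 1 cancels the denominator
-- of b_k.  So h(x+1) - h(x) is a multiple of q^((r-d)x) times
-- ∑ (-1)^(n-k) C(n,k) k(k-1)⋯(k-d+1) y^k = n(n-1)⋯(n-d+1) y^d (y-1)^(n-d) at
-- y = q^x, that is, it equals n(n-1)⋯(n-d+1) q^(rx) [x]^(n-d).  The sum telescopes.

module Submission where

open import Defs
open import Data.Nat.Base as ℕ using (ℕ; zero; suc; _∸_; z≤n; s≤s)
open import Data.Nat.Properties as ℕₚ using (m+[n∸m]≡n; m∸n+n≡m)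
open import Data.Nat.Combinatorics using (_C_; nC1≡n; nCk+nC[k+1]≡[n+1]C[k+1])
open import Data.Nat.Combinatorics.Specification using (k>n⇒nCk≡0)
open import Data.Nat.Tactic.RingSolver using (solve-∀)
import Data.Integer.Base as ℤ
open import Data.Fin.Base using (Fin; zero; suc; toℕ)
open import Function.Base using (_∘_)
open import Relation.Binary.PropositionalEquality as ≡ using (_≡_)
open import Algebra.Bundles using (CommutativeRing)
open import Algebra.Apartness.Bundles using (HeytingField)
import Algebra.Apartness.Properties.HeytingCommutativeRing as HeytingProperties
import Algebra.Properties.AbelianGroup as AbelianGroupProperties
import Algebra.Properties.CommutativeMonoid.Sum as CommutativeMonoidSum
import Algebra.Properties.CommutativeSemiring.Binomial as Binomial
import Algebra.Properties.CommutativeSemiring.Exp as Exp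
import Algebra.Properties.Monoid.Sum as MonoidSum
import Algebra.Properties.Semiring.Mult as Mult
import Algebra.Properties.Semiring.Sum as SemiringSum
import Algebra.Solver.Ring.NaturalCoefficients.Default as SemiringSolver
import Relation.Binary.Reasoning.Setoid as SetoidReasoning

-- The absorption identity for binomial coefficients.

-- Induction on `n`: Pascal's rule splits the coefficient on the left, the induction hypothesis at
-- `k` and at `suc k` turns the pieces into multiples of `suc n`, and Pascal's rule reassembles
-- them.
[1+k]*[1+n]C[1+k]≡[1+n]*nCk : ∀ n k → suc k ℕ.* (suc n C suc k) ≡ suc n ℕ.* (n C k)
[1+k]*[1+n]C[1+k]≡[1+n]*nCk n zero =
  ≡.trans (ℕₚ.*-identityˡ _) (≡.trans (nC1≡n (suc n)) (≡.sym (ℕₚ.*-identityʳ (suc n))))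
[1+k]*[1+n]C[1+k]≡[1+n]*nCk zero (suc k) =
  ≡.trans (≡.cong (suc (suc k) ℕ.*_) (k>n⇒nCk≡0 {1} {suc (suc k)} (s≤s (s≤s z≤n))))
    (≡.trans (ℕₚ.*-zeroʳ (suc (suc k)))
      (≡.sym (≡.trans (ℕₚ.*-identityˡ (0 C suc k)) (k>n⇒nCk≡0 {0} {suc k} (s≤s z≤n)))))
[1+k]*[1+n]C[1+k]≡[1+n]*nCk (suc n) (suc k) = begin
  suc (suc k) ℕ.* (suc (suc n) C suc (suc k))
    ≡⟨ ≡.cong (suc (suc k) ℕ.*_) (≡.sym (nCk+nC[k+1]≡[n+1]C[k+1] (suc n) (suc k))) ⟩
  suc (suc k) ℕ.* (a ℕ.+ (suc n C suc (suc k)))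
    -- One copy of `a` is set aside; at the end it raises the factor `suc n` to `suc (suc n)`.
    ≡⟨ distrib k a _ ⟩
  a ℕ.+ (suc k ℕ.* a ℕ.+ suc (suc k) ℕ.* (suc n C suc (suc k)))
    ≡⟨ ≡.cong (a ℕ.+_) (≡.cong₂ ℕ._+_ ([1+k]*[1+n]C[1+k]≡[1+n]*nCk n k)
                                      ([1+k]*[1+n]C[1+k]≡[1+n]*nCk n (suc k))) ⟩
  a ℕ.+ (suc n ℕ.* (n C k) ℕ.+ suc n ℕ.* (n C suc k))
    ≡⟨ ≡.cong (a ℕ.+_) (≡.sym (ℕₚ.*-distribˡ-+ (suc n) (n C k) (n C suc k))) ⟩
  a ℕ.+ suc n ℕ.* ((n C k) ℕ.+ (n C suc k))
    ≡⟨ ≡.cong (λ z → a ℕ.+ suc n ℕ.* z) (nCk+nC[k+1]≡[n+1]C[k+1] n k) ⟩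
  suc (suc n) ℕ.* a ∎
  where
  open ≡.≡-Reasoning
  a = suc n C suc k
  distrib : ∀ k a b →
    suc (suc k) ℕ.* (a ℕ.+ b) ≡ a ℕ.+ (suc k ℕ.* a ℕ.+ suc (suc k) ℕ.* b)
  distrib = solve-∀

module _ {ℓ₀ ℓ₁ ℓ₂} (ℝ : RealNumbers ℓ₀ ℓ₁ ℓ₂) where
  open RealNumbers ℝ
  open RealProperties ℝ
  open CommutativeRing commutativeRing
    using (semiring; commutativeSemiring; +-abelianGroup; +-commutativeMonoid; *-monoid)
  open AbelianGroupProperties +-abelianGroup using (xyx⁻¹≈y; ⁻¹-∙-comm)
  open HeytingProperties (HeytingField.heytingCommutativeRing heytingField) using (x-0≈x)
  open SetoidReasoning setoid
  open SemiringSolver commutativeSemiring using (solve; _:=_; _:+_; _:*_)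
  open Exp commutativeSemiring using (^-congˡ; ^-congʳ; ^-homo-*; ^-assocʳ; ^-distrib-*)
  open Mult semiring using (×-assoc-*; ×1-homo-*; ×-congʳ)
  open CommutativeMonoidSum +-commutativeMonoid using (sum-cong-≋; ∑-distrib-+)
  open SemiringSum semiring using (*-distribˡ-sum; *-distribʳ-sum)

  -- Telescoping sums and division.

  ∑-telescope : ∀ (f : ℕ → Carrier) n →
    sum {n} (λ k → f (suc (toℕ k)) - f (toℕ k)) ≈ f n - f 0
  ∑-telescope f zero    = sym (-‿inverseʳ (f 0))
  ∑-telescope f (suc n) = begin
    f 1 - f 0 + sum {n} (λ k → f (suc (suc (toℕ k))) - f (suc (toℕ k)))
      -- `sum` peels off its first term, so the induction passes to the shifted sequence `f ∘ suc`.
      ≈⟨ +-congˡ (∑-telescope (f ∘ suc) n) ⟩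
    f 1 - f 0 + (f (suc n) - f 1)
      -- The solver works in commutative semirings: negated values enter as independent atoms, and
      -- the cancellation itself is left to `xyx⁻¹≈y`.
      ≈⟨ solve 4 (λ x y z x′ → (x :+ y :+ (z :+ x′)) := (x :+ (z :+ y) :+ x′)) refl
           (f 1) (- f 0) (f (suc n)) (- f 1) ⟩
    f 1 + (f (suc n) - f 0) - f 1
      ≈⟨ xyx⁻¹≈y (f 1) _ ⟩
    f (suc n) - f 0 ∎

  x*y≈z⇒x≈z/y : ∀ {x y z} (y#0 : y # 0#) → x * y ≈ z → x ≈ z / y ⟨ y#0 ⟩
  x*y≈z⇒x≈z/y {x} {y} {z} y#0 eq = begin
    x                   ≈⟨ *-identityʳ x ⟨
    x * 1#              ≈⟨ *-congˡ (*-invʳ y#0) ⟨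
    x * (y * inv y y#0) ≈⟨ *-assoc x y _ ⟨
    x * y * inv y y#0   ≈⟨ *-congʳ eq ⟩
    z / y ⟨ y#0 ⟩       ∎

  inv-^-cancel : ∀ {x} (x#0 : x # 0#) m d → inv x x#0 ^ (m ℕ.+ d) * x ^ d ≈ inv x x#0 ^ m
  inv-^-cancel {x} x#0 m d = begin
    v ^ (m ℕ.+ d) * x ^ d   ≈⟨ *-congʳ (^-homo-* v m d) ⟩
    v ^ m * v ^ d * x ^ d   ≈⟨ *-assoc _ _ _ ⟩
    v ^ m * (v ^ d * x ^ d) ≈⟨ *-congˡ (^-distrib-* v x d) ⟨
    v ^ m * (v * x) ^ d     ≈⟨ *-congˡ (^-congˡ d (trans (*-comm v x) (*-invʳ x#0))) ⟩
    v ^ m * 1# ^ d          ≈⟨ *-congˡ (1^n≈1 d) ⟩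
    v ^ m * 1#              ≈⟨ *-identityʳ _ ⟩
    v ^ m                   ∎
    where
    v = inv x x#0
    1^n≈1 : ∀ n → 1# ^ n ≈ 1#
    1^n≈1 zero    = refl
    1^n≈1 (suc n) = trans (*-identityˡ _) (1^n≈1 n)

  -- Falling factorials and the binomial theorem.

  falling-0-suc : ∀ d → falling 0 (suc d) ≈ 0#
  falling-0-suc d = trans (*-congʳ (-‿inverseʳ 0#)) (zeroˡ _)

  falling-suc-suc : ∀ k d → falling (suc k) (suc d) ≈ ι (suc k) * falling k d
  falling-suc-suc k d = *-cong
    (x-0≈x (ι (suc k)))
    -- `product` is the monoid sum of `*-monoid`, so this congruence compares the two products
    -- factor by factor.
    (MonoidSum.sum-cong-≋ *-monoid {d} (difference ∘ toℕ))
    where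
    difference : ∀ i → ι (suc k) - ι (suc i) ≈ ι k - ι i
    difference i = begin
      1# + ι k - (1# + ι i)
        ≈⟨ +-congˡ (⁻¹-∙-comm 1# (ι i)) ⟨
      1# + ι k + (- 1# - ι i)
        ≈⟨ solve 4 (λ u x u′ y → (u :+ x :+ (u′ :+ y)) := (u :+ (x :+ y) :+ u′)) refl
             1# (ι k) (- 1#) (- ι i) ⟩
      1# + (ι k - ι i) - 1#
        ≈⟨ xyx⁻¹≈y 1# _ ⟩
      ι k - ι i ∎

  ι-absorb : ∀ n k → ι (suc k) * ι (suc n C suc k) ≈ ι (suc n) * ι (n C k)
  ι-absorb n k = begin
    ι (suc k) * ι (suc n C suc k) ≈⟨ ×1-homo-* (suc k) (suc n C suc k) ⟨
    ι (suc k ℕ.* (suc n C suc k)) ≡⟨ ≡.cong ι ([1+k]*[1+n]C[1+k]≡[1+n]*nCk n k) ⟩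
    ι (suc n ℕ.* (n C k))         ≈⟨ ×1-homo-* (suc n) (n C k) ⟩
    ι (suc n) * ι (n C k)         ∎

  fallingBinomialTerm : (n d : ℕ) (x : Carrier) (k : ℕ) → Carrier
  fallingBinomialTerm n d x k = (- 1#) ^ (n ∸ k) * ι (n C k) * falling k d * x ^ k

  -- The right side is `x ^ d` times the `d`-th derivative of `(x - 1#) ^ n`. In place of
  -- differentiation, absorption lowers `n`, `d` and `k` together, each step releasing a factor
  -- `ι (suc n) * x`, until `d = 0` leaves the binomial theorem.
  ∑-fallingBinomialTerm : ∀ {n d} → d ℕ.≤ n → ∀ x →
    sum {suc n} (λ k → fallingBinomialTerm n d x (toℕ k)) ≈
    falling n d * (x ^ d * (x - 1#) ^ (n ∸ d))
  ∑-fallingBinomialTerm {n} {zero} _ x = begin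
    sum {suc n} (λ k → fallingBinomialTerm n 0 x (toℕ k))
      ≈⟨ sum-cong-≋ {suc n} (λ k → term (toℕ k)) ⟩
    Binomial.binomialExpansion commutativeSemiring x (- 1#) n
      ≈⟨ Binomial.theorem commutativeSemiring n x (- 1#) ⟨
    (x - 1#) ^ n
      ≈⟨ trans (*-identityˡ _) (*-identityˡ _) ⟨
    1# * (1# * (x - 1#) ^ n) ∎
    where
    term : ∀ k → fallingBinomialTerm n 0 x k ≈ (n C k) ℕ× (x ^ k * (- 1#) ^ (n ∸ k))
    term k = begin
      s * ι (n C k) * 1# * x ^ k   ≈⟨ *-congʳ (*-identityʳ _) ⟩
      s * ι (n C k) * x ^ k        ≈⟨ solve 3 (λ s c y → (s :* c :* y) := (c :* (y :* s))) refl s (ι (n C k)) (x ^ k) ⟩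
      ι (n C k) * (x ^ k * s)      ≈⟨ ×-assoc-* (n C k) 1# _ ⟩
      (n C k) ℕ× (1# * (x ^ k * s)) ≈⟨ ×-congʳ (n C k) (*-identityˡ _) ⟩
      (n C k) ℕ× (x ^ k * s)       ∎
      where s = (- 1#) ^ (n ∸ k)
  ∑-fallingBinomialTerm {suc n} {suc d} (s≤s d≤n) x = begin
    fallingBinomialTerm (suc n) (suc d) x 0 +
      sum {suc n} (λ k → fallingBinomialTerm (suc n) (suc d) x (suc (toℕ k)))
      -- The term at `k = 0` drops out because `falling 0 (suc d)` contains the factor `0# - 0#`;
      -- the others match the sum for `n` and `d` index by index.
      ≈⟨ +-cong head (sum-cong-≋ {suc n} (λ k → term (toℕ k))) ⟩
    0# + sum {suc n} (λ k → ι (suc n) * x * fallingBinomialTerm n d x (toℕ k))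
      ≈⟨ +-identityˡ _ ⟩
    sum {suc n} (λ k → ι (suc n) * x * fallingBinomialTerm n d x (toℕ k))
      ≈⟨ *-distribˡ-sum {suc n} (ι (suc n) * x) (fallingBinomialTerm n d x ∘ toℕ) ⟨
    ι (suc n) * x * sum {suc n} (λ k → fallingBinomialTerm n d x (toℕ k))
      ≈⟨ *-congˡ (∑-fallingBinomialTerm d≤n x) ⟩
    ι (suc n) * x * (falling n d * (x ^ d * (x - 1#) ^ (n ∸ d)))
      ≈⟨ solve 5 (λ a x f y z → (a :* x :* (f :* (y :* z))) := (a :* f :* (x :* y :* z))) refl
           (ι (suc n)) x (falling n d) (x ^ d) ((x - 1#) ^ (n ∸ d)) ⟩
    ι (suc n) * falling n d * (x * x ^ d * (x - 1#) ^ (n ∸ d))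
      ≈⟨ *-congʳ (falling-suc-suc n d) ⟨
    falling (suc n) (suc d) * (x * x ^ d * (x - 1#) ^ (n ∸ d)) ∎
    where
    head : fallingBinomialTerm (suc n) (suc d) x 0 ≈ 0#
    head = trans (*-congʳ (trans (*-congˡ (falling-0-suc d)) (zeroʳ _))) (zeroˡ _)
    term : ∀ k → fallingBinomialTerm (suc n) (suc d) x (suc k) ≈
                 ι (suc n) * x * fallingBinomialTerm n d x k
    term k = begin
      -- `suc n ∸ suc k` computes to `n ∸ k`, so the sign `s` is common to both sides.
      s * ι (suc n C suc k) * falling (suc k) (suc d) * (x * x ^ k)
        ≈⟨ *-congʳ (*-congˡ (falling-suc-suc k d)) ⟩
      s * ι (suc n C suc k) * (ι (suc k) * f) * (x * x ^ k)
        ≈⟨ solve 6 (λ s c a f x y → (s :* c :* (a :* f) :* (x :* y)) := ((a :* c) :* (s :* f :* x :* y)))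
             refl s (ι (suc n C suc k)) (ι (suc k)) f x (x ^ k) ⟩
      ι (suc k) * ι (suc n C suc k) * (s * f * x * x ^ k)
        ≈⟨ *-congʳ (ι-absorb n k) ⟩
      ι (suc n) * ι (n C k) * (s * f * x * x ^ k)
        ≈⟨ solve 6 (λ s c a f x y → ((a :* c) :* (s :* f :* x :* y)) := (a :* x :* (s :* c :* f :* y)))
             refl s (ι (n C k)) (ι (suc n)) f x (x ^ k) ⟩
      ι (suc n) * x * (s * ι (n C k) * f * x ^ k) ∎
      where
      s = (- 1#) ^ (n ∸ k)
      f = falling k d

  -- Powers of `q` and of `q - 1#`.

  module _ (q : Carrier) (0<q : 0# < q) (q#1 : q # 1#) where
    open QCalculus q 0<q q#1

    private
      w v : Carrier
      w = q - 1#
      v = inv w q-1#0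

    -- Integer negation computes only once `n` is a constructor, hence the case split.
    [q-1]^-n : ∀ n → [q-1]^ (ℤ.- (ℤ.+ n)) ≈ v ^ n
    [q-1]^-n zero    = refl
    [q-1]^-n (suc n) = refl

    -- At `d = 0` the exponent is -1 and the power is the inverse `v`; for a successor the exponent
    -- computes to a natural number.
    [q-1]^[d-1]*[q-1] : ∀ d → [q-1]^ (ℤ.+ d ℤ.- ℤ.+ 1) * w ≈ w ^ d
    [q-1]^[d-1]*[q-1] zero    = trans (*-congʳ (*-identityʳ v)) (trans (*-comm v w) (*-invʳ q-1#0))
    [q-1]^[d-1]*[q-1] (suc d) = *-comm (w ^ d) w

    -- Write `Q` as `1# + (Q - 1#)`: since `Q - 1#` is `w * [ suc j ]`, the second summand loses its
    -- denominator.
    falling/[suc]-cancel : ∀ k d j →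
      falling/[] k d (suc j) * q ^ suc j ≈ falling/[] k d (suc j) + w * falling k d
    falling/[suc]-cancel k d j = begin
      a * i * Q
        ≈⟨ *-congˡ (trans (sym (xyx⁻¹≈y 1# Q)) (+-assoc 1# Q (- 1#))) ⟩
      a * i * (1# + (Q - 1#))
        ≈⟨ distribˡ (a * i) 1# (Q - 1#) ⟩
      a * i * 1# + a * i * (Q - 1#)
        -- The factor `w * v`, equal to 1, is inserted so that `(Q - 1#) * v`, which is `[ suc j ]`
        -- by definition, can meet its inverse `i`.
        ≈⟨ +-cong (*-identityʳ _) (sym (trans (*-congˡ (*-invʳ q-1#0)) (*-identityʳ _))) ⟩
      a * i + a * i * (Q - 1#) * (w * v)
        ≈⟨ +-congˡ (solve 5 (λ a i y w v → (a :* i :* y :* (w :* v)) := (w :* a :* (y :* v :* i)))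
                      refl a i (Q - 1#) w v) ⟩
      a * i + w * a * ([ suc j ] * i)
        ≈⟨ +-congˡ (trans (*-congˡ (*-invʳ ([1+m]#0 j))) (*-identityʳ _)) ⟩
      a * i + w * a ∎
      where
      a = falling k d
      i = inv [ suc j ] ([1+m]#0 j)
      Q = q ^ suc j

    -- The hypothesis excludes `d = e = 0`, where `k = 0` would force `w ≈ 0#`. In the case
    -- `k = e = 0` with `d` positive, governed by the convention on `k / [k]`, the power of `q` is 1
    -- and `falling 0 d` vanishes, so both sides reduce to the conventional value.
    falling/[]-cancel : ∀ k d e → 1 ℕ.≤ d ℕ.+ e →
      falling/[] k d (k ℕ.+ e) * q ^ (k ℕ.+ e) ≈ falling/[] k d (k ℕ.+ e) + w * falling k d
    falling/[]-cancel (suc k) d       e       _  = falling/[suc]-cancel (suc k) d (k ℕ.+ e)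
    falling/[]-cancel zero    d       (suc e) _  = falling/[suc]-cancel zero d e
    falling/[]-cancel zero    zero    zero    ()
    falling/[]-cancel zero    (suc d) zero    _  = begin
      a * 1#                    ≈⟨ *-identityʳ a ⟩
      a                         ≈⟨ +-identityʳ a ⟨
      a + 0#                    ≈⟨ +-congˡ (trans (*-congˡ (falling-0-suc d)) (zeroʳ w)) ⟨
      a + w * falling 0 (suc d) ∎
      where a = falling/[] 0 (suc d) 0

    ^-*-suc : ∀ m x → q ^ (m ℕ.* suc x) ≈ q ^ (m ℕ.* x) * q ^ m
    ^-*-suc m x = begin
      q ^ (m ℕ.* suc x)       ≡⟨ ≡.cong (q ^_) (≡.trans (ℕₚ.*-suc m x) (ℕₚ.+-comm m _)) ⟩
      q ^ (m ℕ.* x ℕ.+ m)     ≈⟨ ^-homo-* q (m ℕ.* x) m ⟩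
      q ^ (m ℕ.* x) * q ^ m   ∎

    q^rx*[x]^m : ∀ {r d} → d ℕ.≤ r → ∀ m x →
      v ^ m * (q ^ ((r ∸ d) ℕ.* x) * ((q ^ x) ^ d * (q ^ x - 1#) ^ m)) ≈
      q ^ (r ℕ.* x) * [ x ] ^ m
    q^rx*[x]^m {r} {d} d≤r m x = begin
      v ^ m * (q ^ (e ℕ.* x) * ((q ^ x) ^ d * (q ^ x - 1#) ^ m))
        ≈⟨ solve 4 (λ a b c d → (a :* (b :* (c :* d))) := ((c :* b) :* (d :* a))) refl
             (v ^ m) (q ^ (e ℕ.* x)) ((q ^ x) ^ d) ((q ^ x - 1#) ^ m) ⟩
      (q ^ x) ^ d * q ^ (e ℕ.* x) * ((q ^ x - 1#) ^ m * v ^ m)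
        -- `(q ^ x - 1#) * v` is `[ x ]` by definition, and the exponents of `q` add up as
        -- `d * x + (r - d) * x`.
        ≈⟨ *-cong power (sym (^-distrib-* (q ^ x - 1#) v m)) ⟩
      q ^ (r ℕ.* x) * [ x ] ^ m ∎
      where
      e = r ∸ d
      power : (q ^ x) ^ d * q ^ (e ℕ.* x) ≈ q ^ (r ℕ.* x)
      power = begin
        (q ^ x) ^ d * q ^ (e ℕ.* x)     ≈⟨ *-congʳ (^-assocʳ q x d) ⟩
        q ^ (x ℕ.* d) * q ^ (e ℕ.* x)   ≈⟨ ^-homo-* q (x ℕ.* d) (e ℕ.* x) ⟨
        q ^ (x ℕ.* d ℕ.+ e ℕ.* x)       ≡⟨ ≡.cong (λ y → q ^ (y ℕ.+ e ℕ.* x)) (ℕₚ.*-comm x d) ⟩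
        q ^ (d ℕ.* x ℕ.+ e ℕ.* x)       ≡⟨ ≡.cong (q ^_) (ℕₚ.*-distribʳ-+ x d e) ⟨
        q ^ ((d ℕ.+ e) ℕ.* x)           ≡⟨ ≡.cong (λ y → q ^ (y ℕ.* x)) (m+[n∸m]≡n d≤r) ⟩
        q ^ (r ℕ.* x)                   ∎

    -- The difference equation for `h` and its summation.

    module _ (r d : ℕ) (1≤r : 1 ℕ.≤ r) (d≤r : d ℕ.≤ r) (n : ℕ) (d≤n : d ℕ.≤ n) where

      private
        e m : ℕ
        e = r ∸ d
        m = n ∸ d

        p P : Carrier
        p = [q-1]^ (ℤ.+ d ℤ.- ℤ.+ 1)
        P = [q-1]^ (ℤ.- (ℤ.+ n))

        term : ℕ → ℕ → Carrier
        term x k = (- 1#) ^ (n ∸ k) * ι (n C k) * b r d k * q ^ (k ℕ.* x)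

        h : ℕ → Carrier
        h x = q ^ (e ℕ.* x) * carlitz (b r d) n x

      -- These are all the powers of `q - 1#` in play: exponent `-n` from `carlitz`, `d - 1` from
      -- `b`, and 1 from clearing the denominator. The remaining exponent `-(n - d)` is what
      -- `[ x ] ^ m` requires.
      P*p*w : P * p * w ≈ v ^ m
      P*p*w = begin
        P * p * w              ≈⟨ *-assoc P p w ⟩
        P * (p * w)            ≈⟨ *-cong ([q-1]^-n n) ([q-1]^[d-1]*[q-1] d) ⟩
        v ^ n * w ^ d          ≡⟨ ≡.cong (λ y → v ^ y * w ^ d) (m∸n+n≡m d≤n) ⟨
        v ^ (m ℕ.+ d) * w ^ d  ≈⟨ inv-^-cancel q-1#0 m d ⟩
        v ^ m                  ∎

      -- The prefactor contributes `q ^ e` and the term `q ^ k`; with `e = r ∸ d` their product has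
      -- the same index `k + e` as the denominator of `b r d k`.
      term-step : ∀ x k → q ^ (e ℕ.* suc x) * term (suc x) k ≈
        q ^ (e ℕ.* x) * term x k + p * w * q ^ (e ℕ.* x) * fallingBinomialTerm n d (q ^ x) k
      term-step x k = begin
        q ^ (e ℕ.* suc x) * (s * c * (p * F) * q ^ (k ℕ.* suc x))
          ≈⟨ *-cong (^-*-suc e x) (*-congˡ (^-*-suc k x)) ⟩
        E * q ^ e * (s * c * (p * F) * (K * q ^ k))
          ≈⟨ solve 8 (λ E Qe s c p F K Qk →
               (E :* Qe :* (s :* c :* (p :* F) :* (K :* Qk))) := (E :* (s :* c :* p :* K) :* (F :* (Qk :* Qe))))
               refl E (q ^ e) s c p F K (q ^ k) ⟩
        E * (s * c * p * K) * (F * (q ^ k * q ^ e))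
          ≈⟨ *-congˡ (*-congˡ (^-homo-* q k e)) ⟨
        E * (s * c * p * K) * (F * q ^ (k ℕ.+ e))
          ≈⟨ *-congˡ (falling/[]-cancel k d e (≡.subst (1 ℕ.≤_) (≡.sym (m+[n∸m]≡n d≤r)) 1≤r)) ⟩
        E * (s * c * p * K) * (F + w * f)
          ≈⟨ solve 8 (λ E s c p K F w f →
               (E :* (s :* c :* p :* K) :* (F :+ w :* f)) :=
               (E :* (s :* c :* (p :* F) :* K) :+ p :* w :* E :* (s :* c :* f :* K)))
               refl E s c p K F w f ⟩
        E * (s * c * (p * F) * K) + p * w * E * (s * c * f * K)
          ≈⟨ +-congˡ (*-congˡ (*-congˡ K≈)) ⟩
        E * (s * c * (p * F) * K) + p * w * E * (s * c * f * (q ^ x) ^ k) ∎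
        where
        s = (- 1#) ^ (n ∸ k)
        c = ι (n C k)
        f = falling k d
        F = falling/[] k d (k ℕ.+ e)
        E = q ^ (e ℕ.* x)
        K = q ^ (k ℕ.* x)
        K≈ : K ≈ (q ^ x) ^ k
        K≈ = trans (^-congʳ q (ℕₚ.*-comm k x)) (sym (^-assocʳ q x k))

      h-expand : ∀ x → h x ≈ P * sum {suc n} (λ k → q ^ (e ℕ.* x) * term x (toℕ k))
      h-expand x = begin
        E * (P * S)   ≈⟨ solve 3 (λ E P S → (E :* (P :* S)) := (P :* (E :* S))) refl E P S ⟩
        P * (E * S)   ≈⟨ *-congˡ (*-distribˡ-sum {suc n} E (term x ∘ toℕ)) ⟩
        P * sum {suc n} (λ k → E * term x (toℕ k)) ∎
        where
        E = q ^ (e ℕ.* x)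
        S = sum {suc n} (term x ∘ toℕ)

      -- `falling n d` is kept as a factor, so that a single division after summation suffices.
      h-step : ∀ x → h (suc x) - h x ≈ q ^ (r ℕ.* x) * [ x ] ^ m * falling n d
      h-step x = begin
        h (suc x) - h x
          ≈⟨ +-cong (trans (h-expand (suc x)) (*-congˡ (sum-cong-≋ {suc n} (term-step x ∘ toℕ))))
                    (-‿cong (h-expand x)) ⟩
        P * sum {suc n} (λ k → A k + D * B k) - P * sum A
          ≈⟨ +-congʳ (*-congˡ (trans (∑-distrib-+ A (λ k → D * B k))
               (+-congˡ (sym (*-distribˡ-sum D B))))) ⟩
        P * (sum A + D * sum B) - P * sum A
          -- `P * sum A` is the expansion of `h x`, so only the increment survives.
          ≈⟨ trans (+-congʳ (distribˡ P (sum A) (D * sum B))) (xyx⁻¹≈y (P * sum A) _) ⟩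
        P * (D * sum B)
          ≈⟨ *-congˡ (*-congˡ (∑-fallingBinomialTerm d≤n (q ^ x))) ⟩
        P * (p * w * E * (falling n d * G))
          ≈⟨ solve 6 (λ P p w E f G →
               (P :* (p :* w :* E :* (f :* G))) := (P :* p :* w :* (E :* G) :* f)) refl
               P p w E (falling n d) G ⟩
        P * p * w * (E * G) * falling n d
          ≈⟨ *-congʳ (trans (*-congʳ P*p*w) (q^rx*[x]^m d≤r m x)) ⟩
        q ^ (r ℕ.* x) * [ x ] ^ m * falling n d ∎
        where
        E = q ^ (e ℕ.* x)
        D = p * w * E
        G = (q ^ x) ^ d * (q ^ x - 1#) ^ m
        A B : Fin (suc n) → Carrier
        A k = E * term x (toℕ k)
        B k = fallingBinomialTerm n d (q ^ x) (toℕ k)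

      ∑-q^rk*[k]^m : ∀ N →
        sum {N} (λ k → q ^ (r ℕ.* toℕ k) * [ toℕ k ] ^ m) ≈
        (h N - carlitz (b r d) n 0) / falling n d ⟨ falling#0 d≤n ⟩
      ∑-q^rk*[k]^m N = x*y≈z⇒x≈z/y (falling#0 d≤n) (begin
        sum {N} g * falling n d
          ≈⟨ *-distribʳ-sum {N} (falling n d) g ⟩
        sum {N} (λ k → g k * falling n d)
          ≈⟨ sum-cong-≋ {N} (λ k → sym (h-step (toℕ k))) ⟩
        sum {N} (λ k → h (suc (toℕ k)) - h (toℕ k))
          ≈⟨ ∑-telescope h N ⟩
        h N - h 0
          -- At `x = 0` the prefactor of `h` is `q ^ 0`, leaving the bare value of `carlitz`.
          ≈⟨ +-congˡ (-‿cong (trans (*-congʳ (^-congʳ q (ℕₚ.*-zeroʳ e))) (*-identityˡ _))) ⟩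
        h N - carlitz (b r d) n 0 ∎)
        where
        g : Fin N → Carrier
        g k = q ^ (r ℕ.* toℕ k) * [ toℕ k ] ^ m

theorem2p7 :
    ∀ {c ℓ₁ ℓ₂} (ℝ : RealNumbers c ℓ₁ ℓ₂) →
    let open RealNumbers ℝ
        open RealProperties ℝ in
    (q : Carrier) (0<q : 0# < q) (q#1 : q # 1#) →
    let open QCalculus q 0<q q#1 in
    (r d : ℕ) → 1 ℕ.≤ r → d ℕ.≤ r →
    (n : ℕ) (d≤n : d ℕ.≤ n) →
    (N : ℕ) → 1 ℕ.≤ N →
    let T = carlitz (b r d) in
    sum {N} (λ k → q ^ (r ℕ.* toℕ k) * [ toℕ k ] ^ (n ∸ d))
      ≈ (q ^ ((r ∸ d) ℕ.* N) * T n N - T n 0) / falling n d ⟨ falling#0 d≤n ⟩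
theorem2p7 ℝ q 0<q q#1 r d 1≤r d≤r n d≤n N _ = ∑-q^rk*[k]^m ℝ q 0<q q#1 r d 1≤r d≤r n d≤n N
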